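{- For every integer $p \ge 1$ there exist an integer $k$ and a $k$-colourable $(4K_1, C_4, \text{claw})$-free graph $G$ that is not $(k+p)$-mixing.
   Context: All graphs are finite and simple. A $k$-colouring of $G$ is a map $\alpha: V(G)\to\{1,\dots,k\}$ with $\alpha(u)\neq\alpha(v)$ for every edge $uv$; $G$ is $k$-colourable if one exists. The reconfiguration graph $\mathcal{R}_k(G)$ has the $k$-colourings of $G$ as vertices, two being adjacent if they differ on exactly one vertex; $G$ is $k$-mixing if $\mathcal{R}_k(G)$ is connected. A graph is $\mathcal{H}$-free for a set $\mathcal{H}$ of graphs if it contains no induced subgraph isomorphic to any member of $\mathcal{H}$. $4K_1$ is the edgeless graph on 4 vertices, $C_4$ the 4-cycle, and the claw is $K_{1,3}$. -}

module Defs where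

open import Data.Empty using (⊥)
open import Data.Fin.Base using (Fin; zero; toℕ)
open import Data.Fin.Patterns using (0F; 1F; 2F; 3F)
open import Data.Fin.Properties using (_≟_; any?; all?)
open import Data.Fin.Subset using (Subset; _∈_)
open import Data.List.Base using ([]; _∷_)
import Data.List.Membership.Propositional as List
open import Data.Nat.Base using (ℕ; suc; _%_)
import Data.Nat.Properties as ℕ
open import Data.Product using (Σ-syntax; ∃-syntax; ∃!; _×_; _,_; proj₁; proj₂)
open import Data.Sum.Base using (_⊎_; inj₁; inj₂; swap)
open import Data.Vec.Base using (Vec; lookup)
open import Function.Base using (_∘_)
open import Function.Bundles using (_↔_; _⇔_; module Inverse)
open import Level using (0ℓ)
open import Relation.Binary.Construct.Closure.ReflexiveTransitive using (Star)
open import Relation.Binary.Core using (Rel)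
open import Relation.Binary.Definitions using (Symmetric; Decidable)
open import Relation.Binary.PropositionalEquality using (_≡_; _≢_; refl; sym)
open import Relation.Nullary using (¬_; Dec; no)
open import Relation.Nullary.Decidable using (map′; ¬?; _×-dec_; _⊎-dec_; _→-dec_)
open import Relation.Unary using (Pred)

record SimpleGraph (V : Set) : Set₁ where
  field
    Adj        : Rel V 0ℓ
    adj?       : Decidable Adj
    adj-sym    : Symmetric Adj
    adj-irrefl : ∀ {v} → ¬ Adj v v

open SimpleGraph public

FiniteGraph : Set₁
FiniteGraph = Σ[ n ∈ ℕ ] SimpleGraph (Fin n)

infix 4 _≅_

_≅_ : {V W : Set} → SimpleGraph V → SimpleGraph W → Set
_≅_ {V} {W} G H =
  Σ[ f ∈ V ↔ W ] (∀ u v → Adj G u v ⇔ Adj H (Inverse.to f u) (Inverse.to f v))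

Connected : {V : Set} → SimpleGraph V → Set
Connected G = ∀ u v → Star (Adj G) u v

induced : ∀ {n} → SimpleGraph (Fin n) → (S : Subset n) → SimpleGraph (∃[ v ] v ∈ S)
induced G S = record
  { Adj        = λ u v → Adj G (proj₁ u) (proj₁ v)
  ; adj?       = λ u v → adj? G (proj₁ u) (proj₁ v)
  ; adj-sym    = adj-sym G
  ; adj-irrefl = adj-irrefl G
  }

Free : ∀ {ℓ n} → Pred FiniteGraph ℓ → SimpleGraph (Fin n) → Set _
Free {n = n} 𝓗 G = ∀ H → 𝓗 H → ¬ (Σ[ S ∈ Subset n ] induced G S ≅ proj₂ H)

-- Maps V(G) → {1,…,k} are vectors, so that propositional equality of
-- colourings is pointwise equality of maps.  (The field `proper` does not
-- distinguish colourings: ⊥ is definitionally proof-irrelevant.)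
record Colouring {n} (G : SimpleGraph (Fin n)) (k : ℕ) : Set where
  constructor mkColouring
  field
    colours : Vec (Fin k) n
    proper  : ∀ u v → Adj G u v → lookup colours u ≢ lookup colours v

  colour : Fin n → Fin k
  colour = lookup colours

open Colouring public

Colourable : ∀ {n} → ℕ → SimpleGraph (Fin n) → Set
Colourable k G = Colouring G k

module _ {n} {G : SimpleGraph (Fin n)} {k : ℕ} where

  DifferAt : Colouring G k → Colouring G k → Fin n → Set
  DifferAt α β v = colour α v ≢ colour β v

  DifferOnce : Rel (Colouring G k) 0ℓ
  DifferOnce α β = ∃! _≡_ (DifferAt α β)

  differAt? : ∀ α β v → Dec (DifferAt α β v)
  differAt? α β v = ¬? (colour α v ≟ colour β v)

  differOnce? : Decidable DifferOnce
  differOnce? α β = any? λ v →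
    differAt? α β v ×-dec
    map′ (λ h {u} → h u) (λ h u → h {u})
         (all? λ u → differAt? α β u →-dec (v ≟ u))

reconfigurationGraph : ∀ {n} (G : SimpleGraph (Fin n)) (k : ℕ) → SimpleGraph (Colouring G k)
reconfigurationGraph G k = record
  { Adj        = DifferOnce
  ; adj?       = differOnce?
  ; adj-sym    = λ (v , d , unique) → v , d ∘ sym , λ d′ → unique (d′ ∘ sym)
  ; adj-irrefl = λ (_ , d , _) → d refl
  }

Mixing : ∀ {n} → ℕ → SimpleGraph (Fin n) → Set
Mixing k G = Connected (reconfigurationGraph G k)

edgeless : ∀ n → SimpleGraph (Fin n)
edgeless n = record
  { Adj        = λ _ _ → ⊥
  ; adj?       = λ _ _ → no λ ()
  ; adj-sym    = λ ()
  ; adj-irrefl = λ ()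
  }

4K₁ : SimpleGraph (Fin 4)
4K₁ = edgeless 4

C₄ : SimpleGraph (Fin 4)
C₄ = record
  { Adj        = λ u v → Next u v ⊎ Next v u
  ; adj?       = λ u v → next? u v ⊎-dec next? v u
  ; adj-sym    = swap
  ; adj-irrefl = λ { {v} (inj₁ e) → next-irrefl v e ; {v} (inj₂ e) → next-irrefl v e }
  }
  where
  Next : Rel (Fin 4) 0ℓ
  Next u v = toℕ v ≡ suc (toℕ u) % 4

  next? : Decidable Next
  next? u v = toℕ v ℕ.≟ suc (toℕ u) % 4

  next-irrefl : ∀ v → ¬ Next v v
  next-irrefl 0F ()
  next-irrefl 1F ()
  next-irrefl 2F ()
  next-irrefl 3F ()

-- K₁,ₙ with centre `zero`.
star : ∀ n → SimpleGraph (Fin (suc n))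
star n = record
  { Adj        = λ u v → Ray u v ⊎ Ray v u
  ; adj?       = λ u v → ray? u v ⊎-dec ray? v u
  ; adj-sym    = swap
  ; adj-irrefl = λ { (inj₁ (e , ne)) → ne e ; (inj₂ (e , ne)) → ne e }
  }
  where
  Ray : Rel (Fin (suc n)) 0ℓ
  Ray u v = u ≡ zero × v ≢ zero

  ray? : Decidable Ray
  ray? u v = (u ≟ zero) ×-dec ¬? (v ≟ zero)

claw : SimpleGraph (Fin 4)
claw = star 3

⟨4K₁,C₄,claw⟩ : Pred FiniteGraph _
⟨4K₁,C₄,claw⟩ H = H List.∈ (4 , 4K₁) ∷ (4 , C₄) ∷ (4 , claw) ∷ []

{-# OPTIONS --safe #-}
-- Blow up every vertex of the 6-cycle into a clique on p vertices.  The result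
-- inherits (4K₁, C₄, claw)-freeness from C₆.  Colouring the blocks alternately
-- takes 2p colours.  Giving antipodal blocks the same p colours takes 3p
-- colours, and then every vertex sees all the colours other than its own, so
-- this colouring is an isolated vertex of the reconfiguration graph.
module Submission where

open import Defs
open import Data.Empty using (⊥-elim)
open import Data.Fin.Base
  using (Fin; zero; suc; inject₁; opposite; combine; quotient; remainder)
open import Data.Fin.Patterns using (0F; 1F; 2F; 3F)
open import Data.Fin.Properties
  using (_≟_; all?; inject₁-injective; combine-injective; remQuot-combine; combine-remQuot)
open import Data.Fin.Subset using (Subset)
open import Data.List.Relation.Unary.Any using (here; there)
open import Data.Nat.Base using (ℕ; suc; _+_; _*_; _≥_)
open import Data.Nat.Properties using (+-comm)
open import Data.Product.Base using (∃; ∃-syntax; Σ-syntax; _×_; _,_; proj₁; proj₂)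
open import Data.Vec.Base using (tabulate)
open import Data.Vec.Properties using (lookup∘tabulate)
open import Data.Vec.Properties.WithK using ([]=-irrelevant)
open import Function.Base using (_∘_)
open import Function.Bundles using (_⇔_; mk⇔; module Equivalence; module Inverse)
open import Function.Definitions using (Injective)
open import Relation.Binary.Construct.Closure.ReflexiveTransitive using (ε; _◅_)
open import Relation.Binary.PropositionalEquality
open import Relation.Nullary using (¬_; Dec; yes; no)
open import Relation.Nullary.Decidable
  using (map′; ¬?; _×-dec_; _→-dec_; decidable-stable; from-yes; True; False;
         toWitness; toWitnessFalse)

_⇔-dec_ : {A B : Set} → Dec A → Dec B → Dec (A ⇔ B)
a? ⇔-dec b? = map′ (λ (f , g) → mk⇔ f g)
                   (λ e → Equivalence.to e , Equivalence.from e)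
                   ((a? →-dec b?) ×-dec (b? →-dec a?))

module _ {n k : ℕ} {G : SimpleGraph (Fin n)} where

  Frozen : Colouring G k → Set
  Frozen β = ∀ v c → c ≢ colour β v → ∃[ w ] Adj G v w × colour β w ≡ c

  -- Recolouring `v` alone must use a colour that `β` already gives to a neighbour `w` of `v`. As
  -- `w` is not `v`, it keeps that colour in `γ`, contradicting properness of `γ`.
  frozen-isolated : ∀ β γ → Frozen β → ¬ DifferOnce β γ
  frozen-isolated β γ frozen (v , βv≢γv , unique)
    with w , v~w , βw≡γv ← frozen v (colour γ v) (βv≢γv ∘ sym)
    = proper γ v w v~w (trans (sym βw≡γv) βw≡γw)
    where
    βw≡γw : colour β w ≡ colour γ w
    βw≡γw = decidable-stable (colour β w ≟ colour γ w) λ differ →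
      adj-irrefl G (subst (Adj G v) (sym (unique differ)) v~w)

  frozen⇒¬mixing : ∀ α β → Frozen β → ∃ (DifferAt α β) → ¬ Mixing k G
  frozen⇒¬mixing α β frozen (v , αv≢βv) mixing with mixing β α
  ... | ε = αv≢βv refl
  ... | _◅_ {j = γ} βγ _ = frozen-isolated β γ frozen βγ

-- Replaces the subset by an injection from `Fin m`, so that the vertices of a forbidden graph can
-- be named one by one.
induced-embedding : ∀ {n m} (G : SimpleGraph (Fin n)) (H : SimpleGraph (Fin m)) →
  Σ[ S ∈ Subset n ] induced G S ≅ H →
  Σ[ e ∈ (Fin m → Fin n) ] Injective _≡_ _≡_ e × (∀ i j → Adj H i j ⇔ Adj G (e i) (e j))
induced-embedding G H (S , f , f-adj) = proj₁ ∘ from , injective , adj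
  where
  open Inverse f

  -- Membership proofs are unique, so a vertex of the induced subgraph is determined by the
  -- underlying vertex.
  proj₁-injective : ∀ {x y : ∃ _} → proj₁ x ≡ proj₁ y → x ≡ y
  proj₁-injective {v , p} {_ , q} refl = cong (v ,_) ([]=-irrelevant p q)

  injective : Injective _≡_ _≡_ (proj₁ ∘ from)
  injective {i} {j} eq = trans (sym (strictlyInverseˡ i))
    (trans (cong to (proj₁-injective eq)) (strictlyInverseˡ j))

  adj : ∀ i j → Adj H i j ⇔ Adj G (proj₁ (from i)) (proj₁ (from j))
  adj i j = subst₂ (λ i′ j′ → Adj H i′ j′ ⇔ Adj G (proj₁ (from i)) (proj₁ (from j)))
    (strictlyInverseˡ i) (strictlyInverseˡ j)
    (mk⇔ (Equivalence.from (f-adj _ _)) (Equivalence.to (f-adj _ _)))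

-- Vertices of C₆ are pairs in ℤ/2 × ℤ/3 ≅ ℤ/6, so their numbering by Fin 6 is
-- not the cyclic one.
parity : Fin 6 → Fin 2
parity = quotient {2} 3

axis : Fin 6 → Fin 3
axis = remainder {2} 3

-- Two elements of ℤ/2 × ℤ/3 are at cyclic distance at most 1 iff they agree in
-- both coordinates or in neither.
Close : Fin 6 → Fin 6 → Set
Close b c = parity b ≡ parity c ⇔ axis b ≡ axis c

close? : ∀ b c → Dec (Close b c)
close? b c = (parity b ≟ parity c) ⇔-dec (axis b ≟ axis c)

-- Hypotheses come as early as possible to prune the exhaustive search.
no-4K₁ : ∀ a b → ¬ Close a b → ∀ c → ¬ Close a c → ¬ Close b c →
  ∀ d → ¬ Close a d → ¬ Close b d → Close c d
no-4K₁ = from-yes (all? λ a → all? λ b → ¬? (close? a b) →-dec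
  all? λ c → ¬? (close? a c) →-dec ¬? (close? b c) →-dec
  all? λ d → ¬? (close? a d) →-dec ¬? (close? b d) →-dec close? c d)

-- Elements at cyclic distance 2 have only the one between them close to both, and antipodal ones
-- have none; hence `b` and `d` coincide.
no-C₄ : ∀ a c → ¬ Close a c → ∀ b → Close a b → Close b c →
  ∀ d → Close a d → Close d c → Close b d
no-C₄ = from-yes (all? λ a → all? λ c → ¬? (close? a c) →-dec
  all? λ b → close? a b →-dec close? b c →-dec
  all? λ d → close? a d →-dec close? d c →-dec close? b d)

-- The only far pair among the elements close to `o` is its two neighbours on the cycle, so `c`
-- coincides with `b`.
no-claw : ∀ o a → Close o a → ∀ b → Close o b → ¬ Close a b →
  ∀ c → Close o c → ¬ Close a c → Close b c
no-claw = from-yes (all? λ o → all? λ a → close? o a →-dec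
  all? λ b → close? o b →-dec ¬? (close? a b) →-dec
  all? λ c → close? o c →-dec ¬? (close? a c) →-dec close? b c)

module _ (p : ℕ) where

  block : Fin (6 * p) → Fin 6
  block = quotient {6} p

  slot : Fin (6 * p) → Fin p
  slot = remainder {6} p

  vertex : Fin 2 → Fin 3 → Fin p → Fin (6 * p)
  vertex x y a = combine (combine x y) a

  block-vertex : ∀ x y a → block (vertex x y a) ≡ combine x y
  block-vertex x y a = cong proj₁ (remQuot-combine (combine x y) a)

  slot-vertex : ∀ x y a → slot (vertex x y a) ≡ a
  slot-vertex x y a = cong proj₂ (remQuot-combine (combine x y) a)

  parity-vertex : ∀ x y a → parity (block (vertex x y a)) ≡ x
  parity-vertex x y a =
    trans (cong parity (block-vertex x y a)) (cong proj₁ (remQuot-combine x y))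

  axis-vertex : ∀ x y a → axis (block (vertex x y a)) ≡ y
  axis-vertex x y a =
    trans (cong axis (block-vertex x y a)) (cong proj₂ (remQuot-combine x y))

  vertex-coordinates : ∀ v → vertex (parity (block v)) (axis (block v)) (slot v) ≡ v
  vertex-coordinates v = trans
    (cong (λ b → combine b (slot v)) (combine-remQuot {2} 3 (block v)))
    (combine-remQuot {6} p v)

  coordinates-injective : ∀ {v w} → parity (block v) ≡ parity (block w) →
    axis (block v) ≡ axis (block w) → slot v ≡ slot w → v ≡ w
  coordinates-injective {v} {w} x≡ y≡ a≡ = begin
    v                                                   ≡⟨ vertex-coordinates v ⟨
    vertex (parity (block v)) (axis (block v)) (slot v) ≡⟨ cong₂ (λ x y → vertex x y (slot v)) x≡ y≡ ⟩
    vertex (parity (block w)) (axis (block w)) (slot v) ≡⟨ cong (vertex (parity (block w)) (axis (block w))) a≡ ⟩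
    vertex (parity (block w)) (axis (block w)) (slot w) ≡⟨ vertex-coordinates w ⟩
    w                                                   ∎
    where open ≡-Reasoning

  C₆[Kₚ] : SimpleGraph (Fin (6 * p))
  C₆[Kₚ] = record
    { Adj        = λ v w → v ≢ w × Close (block v) (block w)
    ; adj?       = λ v w → ¬? (v ≟ w) ×-dec close? (block v) (block w)
    ; adj-sym    = λ (v≢w , close) → v≢w ∘ sym ,
        mk⇔ (sym ∘ Equivalence.to close ∘ sym) (sym ∘ Equivalence.from close ∘ sym)
    ; adj-irrefl = λ (v≢v , _) → v≢v refl
    }

  module Induced {m : ℕ} (H : SimpleGraph (Fin m))
           (embedding : Σ[ S ∈ Subset (6 * p) ] induced C₆[Kₚ] S ≅ H) where

    image : Fin m → Fin 6
    image = block ∘ proj₁ (induced-embedding C₆[Kₚ] H embedding)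

    near : ∀ i j {_ : True (adj? H i j)} → Close (image i) (image j)
    near i j {i~j} = let _ , _ , adj = induced-embedding C₆[Kₚ] H embedding in
      proj₂ (Equivalence.to (adj i j) (toWitness i~j))

    -- Distinct vertices in the same block are adjacent, and `Close` is reflexive; so non-adjacency
    -- of distinct vertices excludes equal blocks too. The implicit arguments are settled by
    -- evaluation for concrete `i` and `j`.
    far : ∀ i j {_ : False (i ≟ j)} {_ : False (adj? H i j)} → ¬ Close (image i) (image j)
    far i j {i≢j} {i≁j} close = let _ , injective , adj = induced-embedding C₆[Kₚ] H embedding in
      toWitnessFalse i≁j (Equivalence.from (adj i j) (toWitnessFalse i≢j ∘ injective , close))

  C₆[Kₚ]-free : Free ⟨4K₁,C₄,claw⟩ C₆[Kₚ]
  C₆[Kₚ]-free _ (here refl) S≅H = far 2F 3F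
    (no-4K₁
      (image 0F) (image 1F) (far 0F 1F)
      (image 2F) (far 0F 2F) (far 1F 2F)
      (image 3F) (far 0F 3F) (far 1F 3F))
    where open Induced 4K₁ S≅H
  C₆[Kₚ]-free _ (there (here refl)) S≅H = far 1F 3F
    (no-C₄
      (image 0F) (image 2F) (far 0F 2F)
      (image 1F) (near 0F 1F) (near 1F 2F)
      (image 3F) (near 0F 3F) (near 3F 2F))
    where open Induced C₄ S≅H
  C₆[Kₚ]-free _ (there (there (here refl))) S≅H = far 2F 3F
    (no-claw
      (image 0F) (image 1F) (near 0F 1F)
      (image 2F) (near 0F 2F) (far 1F 2F)
      (image 3F) (near 0F 3F) (far 1F 3F))
    where open Induced claw S≅H

  -- The palette consists of `m` classes of `p` colours each: `f` selects the class and the slot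
  -- selects the colour within it.
  colouringBy : ∀ {m} (f : Fin (6 * p) → Fin m) →
    (∀ v w → Adj C₆[Kₚ] v w → f v ≡ f w → slot v ≢ slot w) → Colouring C₆[Kₚ] (m * p)
  colouringBy f separates = mkColouring (tabulate c) λ v w v~w cv≡cw →
    let fv≡fw , av≡aw = combine-injective _ _ _ _
          (trans (sym (lookup∘tabulate c v)) (trans cv≡cw (lookup∘tabulate c w)))
    in separates v w v~w fv≡fw av≡aw
    where
    c : Fin (6 * p) → Fin _
    c v = combine (f v) (slot v)

  colour-colouringBy : ∀ {m} (f : Fin (6 * p) → Fin m) separates v →
    colour (colouringBy f separates) v ≡ combine (f v) (slot v)
  colour-colouringBy f _ = lookup∘tabulate _

  -- For close blocks, agreement in one coordinate forces agreement in the other, so the slots must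
  -- tell `v` and `w` apart.
  parity-separates : ∀ v w → Adj C₆[Kₚ] v w →
    parity (block v) ≡ parity (block w) → slot v ≢ slot w
  parity-separates v w (v≢w , close) x≡ a≡ =
    v≢w (coordinates-injective x≡ (Equivalence.to close x≡) a≡)

  axis-separates : ∀ v w → Adj C₆[Kₚ] v w →
    axis (block v) ≡ axis (block w) → slot v ≢ slot w
  axis-separates v w (v≢w , close) y≡ a≡ =
    v≢w (coordinates-injective (Equivalence.from close y≡) y≡ a≡)

  parityColouring : Colouring C₆[Kₚ] (2 * p)
  parityColouring = colouringBy (parity ∘ block) parity-separates

  parityColouring′ : Colouring C₆[Kₚ] (3 * p)
  parityColouring′ = colouringBy (inject₁ ∘ parity ∘ block)
    λ v w v~w → parity-separates v w v~w ∘ inject₁-injective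

  axisColouring : Colouring C₆[Kₚ] (3 * p)
  axisColouring = colouringBy (axis ∘ block) axis-separates

  axisColour : ∀ v → colour axisColouring v ≡ combine (axis (block v)) (slot v)
  axisColour = colour-colouringBy (axis ∘ block) axis-separates

  axisColour-vertex : ∀ x y a → colour axisColouring (vertex x y a) ≡ combine y a
  axisColour-vertex x y a = trans (axisColour (vertex x y a))
    (cong₂ combine (axis-vertex x y a) (slot-vertex x y a))

  axisColouring-frozen : Frozen axisColouring
  axisColouring-frozen v c c≢cv = w , (v≢w , close) , cw≡c
    where
    y = quotient {3} p c
    a = remainder {3} p c

    -- Of the two antipodal blocks using colour c, exactly one is Close to v's.
    x : Fin 2
    x with axis (block v) ≟ y
    ... | yes _ = parity (block v)
    ... | no  _ = opposite (parity (block v))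

    w = vertex x y a

    cw≡c : colour axisColouring w ≡ c
    cw≡c = trans (axisColour-vertex x y a) (combine-remQuot {3} p c)

    v≢w : v ≢ w
    v≢w v≡w = c≢cv (trans (sym cw≡c) (cong (colour axisColouring) (sym v≡w)))

    opposite-≢ : ∀ (i : Fin 2) → i ≢ opposite i
    opposite-≢ 0F ()
    opposite-≢ 1F ()

    agree : parity (block v) ≡ x ⇔ axis (block v) ≡ y
    -- Repeating the test from the definition of `x` makes `x` reduce in each case. Both equations
    -- hold in the first case and both fail in the second.
    agree with axis (block v) ≟ y
    ... | yes yv≡y = mk⇔ (λ _ → yv≡y) (λ _ → refl)
    ... | no  yv≢y = mk⇔ (⊥-elim ∘ opposite-≢ _) (⊥-elim ∘ yv≢y)

    close : Close (block v) (block w)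
    close = subst₂ (λ x′ y′ → parity (block v) ≡ x′ ⇔ axis (block v) ≡ y′)
      (sym (parity-vertex x y a)) (sym (axis-vertex x y a)) agree

  ¬mixing : Fin p → ¬ Mixing (3 * p) C₆[Kₚ]
  ¬mixing a = frozen⇒¬mixing parityColouring′ axisColouring axisColouring-frozen (v , differ)
    where
    -- Axis 2 gives the third colour class, which `inject₁` never reaches from a parity.
    v = vertex 0F 2F a

    differ : DifferAt parityColouring′ axisColouring v
    differ eq with () ← trans (sym (cong inject₁ (parity-vertex 0F 2F a)))
      (trans (proj₁ (combine-injective _ _ _ _ (trans (sym (lookup∘tabulate _ v))
        (trans eq (axisColour v)))))
      (axis-vertex 0F 2F a))

theorem4 : (p : ℕ) → p ≥ 1 →
    ∃[ k ] ∃[ n ] Σ[ G ∈ SimpleGraph (Fin n) ]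
    Colourable k G × Free ⟨4K₁,C₄,claw⟩ G × ¬ Mixing (k + p) G
theorem4 p@(suc _) _ = 2 * p , 6 * p , C₆[Kₚ] p , parityColouring p , C₆[Kₚ]-free p ,
  -- `3 * p` unfolds to `p + 2 * p`, so only the summands need swapping. The slot `zero` exists
  -- because `p` is a successor.
  subst (λ k → ¬ Mixing k (C₆[Kₚ] p)) (+-comm p (2 * p)) (¬mixing p zero)
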